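{- NFS Sort (the algorithm specified in the context, with its implementation constants $S$, $\alpha$, $c$, $K_{\max}$ fixed independently of the input) has worst-case running time $\mathcal{O}(n \log n)$ on input arrays of $n$ finite numeric values.
   Context: NFS Sort is a sequential sorting algorithm for an array of $n$ finite numbers (no NaN or infinities). Running time is measured in the usual unit-cost model (constant-time arithmetic, comparisons, array accesses). Fixed implementation constants, independent of $n$ and of the input: a cleanup bound $S\ge 1$; a progress constant $\alpha$ with $0<\alpha<1$; a nonnegative integer $c$ (the number of consecutive pathological recursive steps permitted); a maximal number of buckets $K_{\max}$. Top level. The algorithm first checks in linear time whether the array is already sorted (then it returns) or reverse sorted (then it reverses the array and returns). Otherwise it determines, in $\mathcal{O}(n)$ time, bounds $\min<\max$ for the values, and calls the recursive core procedure on the whole array with pathological counter $0$. (The bounds may be approximated by sampling; in that case the first scatter step uses two additional buckets, for elements below and above the approximate bounds, and computes the true minimum and maximum, which are used from then on.) After the recursion has terminated, it runs insertion sort once on the entire array. Recursive core procedure, on a contiguous subarray of size $m$ whose elements lie in a given interval $[\mathit{min},\mathit{max}]$, with a given pathological counter: 1. (Except in the initial call) if all elements of the subarray are equal, return; this check takes $\mathcal{O}(m)$ time. 2. Choose a number of buckets $k$, depending only on $m$, with $k\le K_{\max}$ (up to the two additional buckets in the initial call) and $k=\mathcal{O}(m)$. 3. Scatter step: each element $x$ is assigned to the bucket with index $b(x)=\left\lfloor \frac{(x-\mathit{min})(k-1)}{\mathit{max}-\mathit{min}}\right\rfloor\in\{0,\dots,k-1\}$, and the subarray is permuted so that each bucket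 occupies a contiguous region and the bucket regions appear in increasing order of bucket index. The scatter step runs in $\mathcal{O}(m)$ time. If bucket $i$ precedes bucket $j$ (that is, $i<j$), then every element assigned to bucket $i$ is less than or equal to every element assigned to bucket $j$. All other non-recursive bookkeeping consists of a constant number of linear passes over the subarray plus $\mathcal{O}(k)$ work. 4. For each bucket $i$, of size $m_i$: if $m_i\le S$, the bucket is left unchanged (to be handled by the final insertion sort). If $m_i>S$ and $m_i\le\alpha m$ (non-pathological), the core procedure is called on the bucket with the pathological counter reset to $0$. If $m_i>S$ and $m_i>\alpha m$ (pathological), then: if the current pathological counter is less than $c$, the core procedure is called on the bucket with the counter increased by $1$; otherwise the bucket is sorted by a fallback comparison sort and no recursion takes place inside it. In recursive calls the bounds passed are the interval boundaries $\mathit{min}+i\cdot w$ and $\mathit{min}+(i+1)\cdot w$, with $w=\frac{\mathit{max}-\mathit{min}}{k-1}$. The fallback sorter has worst-case running time $\mathcal{O}(q\log q)$ on a subarray of size $q$.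
   Formalization: The array values (and the interval bounds computed from them) and the progress constant α are taken to be rational numbers, with exact arithmetic, instead of arbitrary real numbers. -}

module Defs where

open import Data.Bool.Base using (if_then_else_)
open import Data.Fin.Base using (Fin; zero; suc; toℕ)
open import Data.Integer.Base as ℤ using (ℤ; +_)
import Data.Integer.Properties as ℤ
open import Data.List.Base using (List; []; _∷_; _++_; length; reverse; filter)
import Data.List.Properties as List
import Data.List.Extrema as Extrema
open import Data.List.Relation.Binary.Permutation.Propositional using (_↭_)
open import Data.List.Relation.Binary.Permutation.Propositional.Properties
  using (↭-length)
open import Data.List.Relation.Unary.All using (All)
open import Data.List.Relation.Unary.AllPairs using (allPairs?)
import Data.List.Relation.Unary.Sorted.TotalOrder as Sortedness
import Data.List.Sort.Base as Sort
open import Data.Nat.Base as ℕ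
  using (ℕ; zero; suc; _+_; _*_; _∸_; _≤_; _<_)
open import Data.Nat.Induction using (Acc; acc; <-wellFounded)
open import Data.Nat.Logarithm using (⌊log₂_⌋)
import Data.Nat.Properties as ℕ
open import Data.Product.Base using (_×_; _,_; ∃-syntax)
open import Data.Rational.Base as ℚ using (ℚ; 0ℚ; 1ℚ; floor)
open import Data.Rational.Literals using (fromℤ)
import Data.Rational.Properties as ℚ
open import Data.Unit.Base using (⊤; tt)
open import Function.Base using (id; _∘_)
open import Relation.Binary.Bundles using (DecTotalOrder; TotalOrder)
open import Relation.Binary.PropositionalEquality.Core
  using (refl; subst; sym)
open import Relation.Nullary.Decidable.Core using (Dec; does; yes; no)
open import Relation.Nullary.Negation.Core using (¬_)

ℚ-totalOrder : TotalOrder _ _ _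
ℚ-totalOrder = DecTotalOrder.totalOrder ℚ.≤-decTotalOrder

open Sortedness ℚ-totalOrder public using (Sorted; sorted?)
open Extrema ℚ-totalOrder public using (min; max)
open Sort ℚ-totalOrder public using (SortingAlgorithm)

infix 4 _∈O_

_∈O_ : (ℕ → ℕ) → (ℕ → ℕ) → Set
f ∈O g = ∃[ C ] ∃[ N ] (∀ n → N ≤ n → f n ≤ C * g n)

-- T is any upper bound for the (finite) worst case at each size, small sizes
-- included; the asymptotic comparison is made on T.
WorstCaseO : (List ℚ → ℕ) → (ℕ → ℕ) → Set
WorstCaseO cost g =
  ∃[ T ] ((∀ xs → cost xs ≤ T (length xs)) × T ∈O g)

infix 4 _after_

record Timed (A : Set) : Set where
  constructor _after_
  field
    value : A
    time  : ℕ

open Timed public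

infixl 1 _>>=_ _>>_

return : ∀ {A} → A → Timed A
return x = x after 0

_>>=_ : ∀ {A B} → Timed A → (A → Timed B) → Timed B
m >>= f = value (f (value m)) after time m + time (f (value m))

_>>_ : ∀ {A B} → Timed A → Timed B → Timed B
m >> m′ = m >>= λ _ → m′

spend : ℕ → Timed ⊤
spend t = tt after t

-- The results of the buckets, laid out in increasing order of bucket index.
forBuckets : ∀ {k} → (Fin k → Timed (List ℚ)) → Timed (List ℚ)
forBuckets {zero}  f = return []
forBuckets {suc k} f = do
  ys ← f zero
  zs ← forBuckets (f ∘ suc)
  return (ys ++ zs)

-- The already sorted prefix of the array is stored from right to left, so that
-- insertion scans it from its right end. One unit is charged for each
-- comparison, each shift of an element, and each placement.
insert : ℚ → List ℚ → Timed (List ℚ)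
insert x []       = do
  spend 1
  return (x ∷ [])
insert x (y ∷ ys) = do
  spend 1
  if does (x ℚ.<? y)
    then (do
      spend 1
      zs ← insert x ys
      return (y ∷ zs))
    else (do
      spend 1
      return (x ∷ y ∷ ys))

insertAll : List ℚ → List ℚ → Timed (List ℚ)
insertAll prefix []       = return (reverse prefix)
insertAll prefix (x ∷ xs) = do
  prefix′ ← insert x prefix
  insertAll prefix′ xs

insertionSort : List ℚ → Timed (List ℚ)
insertionSort = insertAll []

fromℕ : ℕ → ℚ
fromℕ n = fromℤ (+ n)

-- Division with p / 0 = 0. The bounds of every call satisfy min < max as soon
-- as k ≥ 2, so the convention only matters for the degenerate choice k = 1.
infixl 7 _/₀_

_/₀_ : ℚ → ℚ → ℚ
p /₀ q with q ℚ.≟ 0ℚ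
... | yes _   = 0ℚ
... | no  q≢0 = ℚ._÷_ p q {{ℚ.≢-nonZero q≢0}}

bucketIndex : (lo hi : ℚ) (k : ℕ) → ℚ → ℤ
bucketIndex lo hi k x =
  floor (((x ℚ.- lo) ℚ.* fromℕ (k ∸ 1)) /₀ (hi ℚ.- lo))

bucketBounds : (lo hi : ℚ) (k : ℕ) → ℕ → ℚ × ℚ
bucketBounds lo hi k i =
  lo ℚ.+ fromℕ i ℚ.* w , lo ℚ.+ fromℕ (suc i) ℚ.* w
  where w = (hi ℚ.- lo) /₀ fromℕ (k ∸ 1)

-- With approximate bounds, bucket 0 holds the elements below lo, buckets
-- 1, …, k are the ordinary ones, and bucket k + 1 holds the elements above hi.
approxBucketIndex : (lo hi : ℚ) (k : ℕ) → ℚ → ℤ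
approxBucketIndex lo hi k x =
  if does (x ℚ.<? lo) then + 0
  else if does (hi ℚ.<? x) then + suc k
  else ℤ.suc (bucketIndex lo hi k x)

-- min lo xs and max hi xs are the least and greatest elements of lo ∷ xs and
-- hi ∷ xs: the true extrema of xs whenever the respective outer bucket is
-- nonempty.
approxBucketBounds : (xs : List ℚ) (lo hi : ℚ) (k : ℕ) → ℕ → ℚ × ℚ
approxBucketBounds xs lo hi k zero    = min lo xs , lo
approxBucketBounds xs lo hi k (suc i) =
  if does (i ℕ.≟ k) then (hi , max hi xs) else bucketBounds lo hi k i

data InitialBounds (xs : List ℚ) : Set where
  exact       : ∀ lo hi → lo ℚ.< hi →
                All (λ x → lo ℚ.≤ x × x ℚ.≤ hi) xs → InitialBounds xs
  approximate : ∀ lo hi → lo ℚ.< hi → InitialBounds xs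

-- The order inside a bucket is left open. When every index lies in
-- {0, …, k - 1}, the concatenated regions are a permutation of xs.
record Scattered (k : ℕ) (index : ℚ → ℤ) (xs : List ℚ) : Set where
  field
    region   : Fin k → List ℚ
    region-↭ : ∀ i → region i ↭ filter (λ x → index x ℤ.≟ + toℕ i) xs

-- Everything about an implementation that the description of the algorithm
-- leaves open. Steps whose result is determined are given by their cost only.
record Implementation : Set where
  field
    S    : ℕ
    1≤S  : 1 ≤ S
    α    : ℚ
    0<α  : 0ℚ ℚ.< α
    α<1  : α ℚ.< 1ℚ
    c    : ℕ
    Kmax : ℕ

    buckets      : ℕ → ℕ
    1≤buckets    : ∀ m → 1 ≤ buckets m
    buckets≤Kmax : ∀ m → buckets m ≤ Kmax
    buckets-O    : buckets ∈O id

    -- Covers both initial checks: sorted and reverse sorted.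
    orderCheckCost   : List ℚ → ℕ
    orderCheckCost-O : WorstCaseO orderCheckCost id

    initialBounds       : ∀ xs → ¬ Sorted xs → InitialBounds xs
    initialBoundsCost   : List ℚ → ℕ
    initialBoundsCost-O : WorstCaseO initialBoundsCost id

    equalityCheckCost   : List ℚ → ℕ
    equalityCheckCost-O : WorstCaseO equalityCheckCost id

    scatter       : ∀ k index xs → Scattered k index xs
    scatterCost   : (k : ℕ) (index : ℚ → ℤ) (xs : List ℚ) → ℕ
    -- The numbers of buckets that occur are buckets m and, with approximate
    -- bounds, 2 + buckets m, for m the size of the subarray.
    scatterCost-O :
      ∃[ T ] ((∀ k index xs → k ≤ 2 + buckets (length xs) →
               scatterCost k index xs ≤ T (length xs))
             × T ∈O id)

    bookkeepingCost   : (k : ℕ) (xs : List ℚ) → ℕ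
    bookkeepingCost-O :
      ∃[ T ] ∃[ U ] ((∀ k xs → bookkeepingCost k xs ≤ T (length xs) + U k)
                    × T ∈O id × U ∈O id)

    fallback       : SortingAlgorithm
    fallbackCost   : List ℚ → ℕ
    fallbackCost-O : WorstCaseO fallbackCost (λ q → q * ⌊log₂ q ⌋)

module NFSSort (impl : Implementation) where

  open Implementation impl
  open Scattered

  data Treatment (mᵢ m counter : ℕ) : Set where
    leave     : mᵢ ≤ S → Treatment mᵢ m counter
    recurse   : S < mᵢ → fromℕ mᵢ ℚ.≤ α ℚ.* fromℕ m → Treatment mᵢ m counter
    recurse⁺  : S < mᵢ → α ℚ.* fromℕ m ℚ.< fromℕ mᵢ → counter < c →
                Treatment mᵢ m counter
    fall-back : S < mᵢ → α ℚ.* fromℕ m ℚ.< fromℕ mᵢ → c ≤ counter →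
                Treatment mᵢ m counter

  treatment : ∀ mᵢ m counter → Treatment mᵢ m counter
  treatment mᵢ m counter with mᵢ ℕ.≤? S
  ... | yes mᵢ≤S = leave mᵢ≤S
  ... | no  mᵢ≰S with fromℕ mᵢ ℚ.≤? α ℚ.* fromℕ m
  ...   | yes mᵢ≤αm = recurse (ℕ.≰⇒> mᵢ≰S) mᵢ≤αm
  ...   | no  mᵢ≰αm with counter ℕ.<? c
  ...     | yes counter<c = recurse⁺ (ℕ.≰⇒> mᵢ≰S) (ℚ.≰⇒> mᵢ≰αm) counter<c
  ...     | no  counter≮c =
    fall-back (ℕ.≰⇒> mᵢ≰S) (ℚ.≰⇒> mᵢ≰αm) (ℕ.≮⇒≥ counter≮c)

  -- Decreases in every recursive call: the size shrinks when the counter is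
  -- reset, and does not grow when the counter is increased.
  measure : (m counter : ℕ) → ℕ
  measure m counter = m * suc c + (c ∸ counter)

  non-pathological-< : ∀ {mᵢ m} → S < mᵢ → mᵢ ≤ m → fromℕ mᵢ ℚ.≤ α ℚ.* fromℕ m → mᵢ < m
  non-pathological-< {suc _} {zero}  _ () _
  non-pathological-< {zero}  {m}     () _ _
  non-pathological-< {suc mᵢ} {m@(suc _)} _ mᵢ≤m mᵢ≤αm = ℕ.≰⇒> λ m≤mᵢ →
    ℚ.<-irrefl refl (ℚ.≤-<-trans (fromℕ-mono m≤mᵢ) (ℚ.≤-<-trans mᵢ≤αm
      (subst (α ℚ.* fromℕ m ℚ.<_) (ℚ.*-identityˡ (fromℕ m))
        (ℚ.*-monoˡ-<-pos (fromℕ m) α<1))))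
    where
    fromℕ-mono : ∀ {a b} → a ≤ b → fromℕ a ℚ.≤ fromℕ b
    fromℕ-mono {a} {b} a≤b = ℚ.*≤*
      (ℤ.*-monoʳ-≤-nonNeg (+ 1) (ℤ.+≤+ a≤b))

  measure-recurse : ∀ {mᵢ m} counter → mᵢ < m → measure mᵢ 0 < measure m counter
  measure-recurse {mᵢ} {m} counter mᵢ<m = begin-strict
    mᵢ * suc c + c              <⟨ ℕ.+-monoʳ-< (mᵢ * suc c) (ℕ.n<1+n c) ⟩
    mᵢ * suc c + suc c          ≡⟨ ℕ.+-comm (mᵢ * suc c) (suc c) ⟩
    suc mᵢ * suc c              ≤⟨ ℕ.*-monoˡ-≤ (suc c) mᵢ<m ⟩
    m * suc c                   ≤⟨ ℕ.m≤m+n (m * suc c) (c ∸ counter) ⟩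
    m * suc c + (c ∸ counter)   ∎
    where open ℕ.≤-Reasoning

  measure-recurse⁺ : ∀ {mᵢ m counter} → mᵢ ≤ m → counter < c →
                     measure mᵢ (suc counter) < measure m counter
  measure-recurse⁺ mᵢ≤m counter<c =
    ℕ.+-mono-≤-< (ℕ.*-monoˡ-≤ (suc c) mᵢ≤m) (ℕ.∸-monoʳ-< (ℕ.n<1+n _) counter<c)

  region-length : ∀ {k index xs} (σ : Scattered k index xs) i →
                  length (region σ i) ≤ length xs
  region-length {index = index} {xs} σ i =
    subst (_≤ length xs) (sym (↭-length (region-↭ σ i)))
      (List.length-filter (λ x → index x ℤ.≟ + toℕ i) xs)

  mutual

    core : (xs : List ℚ) (bounds : ℚ × ℚ) (counter : ℕ) →
           Acc _<_ (measure (length xs) counter) → Timed (List ℚ)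
    core xs (lo , hi) counter wf = do
      spend (equalityCheckCost xs)
      if does (allPairs? ℚ._≟_ xs)
        then return xs
        else distribute xs k (bucketIndex lo hi k) (bucketBounds lo hi k)
               counter wf
      where k = buckets (length xs)

    distribute : (xs : List ℚ) (k : ℕ) (index : ℚ → ℤ) (bounds : ℕ → ℚ × ℚ)
                 (counter : ℕ) → Acc _<_ (measure (length xs) counter) →
                 Timed (List ℚ)
    distribute xs k index bounds counter wf = do
      spend (scatterCost k index xs)
      spend (bookkeepingCost k xs)
      forBuckets λ i →
        treat (region σ i) (bounds (toℕ i)) (region-length σ i) wf
          (treatment (length (region σ i)) (length xs) counter)
      where σ = scatter k index xs

    treat : ∀ {m counter} (ys : List ℚ) (bounds : ℚ × ℚ) → length ys ≤ m →
            Acc _<_ (measure m counter) → Treatment (length ys) m counter →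
            Timed (List ℚ)
    treat ys bounds _ _ (leave _) = return ys
    treat {counter = counter} ys bounds ys≤m (acc rs) (recurse S< ≤αm) =
      core ys bounds 0 (rs (measure-recurse counter (non-pathological-< S< ys≤m ≤αm)))
    treat {counter = counter} ys bounds ys≤m (acc rs) (recurse⁺ _ _ counter<c) =
      core ys bounds (suc counter) (rs (measure-recurse⁺ ys≤m counter<c))
    treat ys _ _ _ (fall-back _ _ _) = do
      spend (fallbackCost ys)
      return (SortingAlgorithm.sort fallback ys)

  initial : (xs : List ℚ) → InitialBounds xs → Timed (List ℚ)
  initial xs (exact lo hi _ _) =
    distribute xs k (bucketIndex lo hi k) (bucketBounds lo hi k)
      0 (<-wellFounded _)
    where k = buckets (length xs)
  initial xs (approximate lo hi _) =
    distribute xs (2 + k) (approxBucketIndex lo hi k)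
      (approxBucketBounds xs lo hi k) 0 (<-wellFounded _)
    where k = buckets (length xs)

  sortUnlessSorted : (xs : List ℚ) → Dec (Sorted xs) → Timed (List ℚ)
  sortUnlessSorted xs (yes _)        = return xs
  sortUnlessSorted xs (no  unsorted) =
    if does (sorted? ℚ._≤?_ (reverse xs))
      then (do
        spend (length xs)  -- one unit for each element moved
        return (reverse xs))
      else (do
        spend (initialBoundsCost xs)
        ys ← initial xs (initialBounds xs unsorted)
        insertionSort ys)

  sort : List ℚ → Timed (List ℚ)
  sort xs = do
    spend (orderCheckCost xs)
    sortUnlessSorted xs (sorted? ℚ._≤?_ xs)

{-# OPTIONS --safe #-}
module Submission where

-- Since α < 1, there is r ≥ 1 with α ≤ r / (1 + r), so a non-pathological call
-- shrinks the size by the factor r / (1 + r), and at most c pathological ones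
-- separate two of them: the recursion has depth O(log n). The buckets of a call
-- are disjoint and its own work is linear, so each level of the recursion costs
-- O(n); the fallback sorts run on disjoint subarrays and cost O(n log n) in all.
-- Assigning buckets is monotone and preserves order between buckets, so the
-- only inversions left after the recursion are inside buckets of size at most S;
-- there are at most S n of them, and insertion sort takes O(n + inversions) time.

open import Algebra.Properties.CommutativeSemigroup using (x∙yz≈y∙xz; interchange)
open import Data.Bool.Base using (if_then_else_)
open import Data.Fin.Base using (Fin; zero; suc; toℕ)
import Data.Fin.Properties as Fin
open import Data.Integer.Base as ℤ using (ℤ; +_; -[1+_])
import Data.Integer.DivMod as ℤ
import Data.Integer.Properties as ℤ
open import Data.Integer.Tactic.RingSolver using () renaming (solve-∀ to ℤ-solve-∀)
open import Data.List.Base using (List; []; _∷_; _++_; length; reverse; filter; tabulate)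
import Data.List.Extrema as Extrema
import Data.List.Properties as List
open import Data.List.Relation.Binary.Permutation.Propositional
  using (_↭_; ↭-refl; ↭-sym; ↭-trans; prep; swap)
open import Data.List.Relation.Binary.Permutation.Propositional.Properties
  using (↭-length; All-resp-↭; filter-↭)
open import Data.List.Relation.Unary.All as All using (All; []; _∷_)
import Data.List.Relation.Unary.All.Properties as All
open import Data.List.Relation.Unary.AllPairs as AllPairs using (AllPairs; []; _∷_; allPairs?)
open import Data.List.Relation.Unary.Linked using ([])
open import Data.List.Relation.Unary.Sorted.TotalOrder.Properties using (Sorted⇒AllPairs)
open import Data.Nat.Base
open import Data.Nat.DivMod using (n/1≡n)
open import Data.Nat.Induction using (acc)
open import Data.Nat.ListAction using (sum)
open import Data.Nat.Logarithm using (⌊log₂_⌋; ⌊log₂⌋-mono-≤; ⌊log₂[2^n]⌋≡n)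
open import Data.Nat.Properties
open import Data.Nat.Tactic.RingSolver using (solve-∀)
open import Data.Product.Base using (_×_; _,_; proj₁; proj₂; ∃-syntax)
open import Data.Rational.Base as ℚ using (ℚ; mkℚ; 0ℚ; 1ℚ; floor; *≤*; *<*)
import Data.Rational.Properties as ℚ
import Data.Rational.Unnormalised.Base as ℚᵘ
import Data.Rational.Unnormalised.Properties as ℚᵘ
open import Data.Sum.Base using ([_,_]′)
open import Data.Unit.Base using (⊤; tt)
open import Function.Base using (id; _∘_)
open import Level using (0ℓ)
open import Relation.Binary.PropositionalEquality
open import Relation.Nullary.Decidable.Core using (Dec; does; yes; no)
open import Relation.Nullary.Negation.Core using (¬_; contradiction)
open import Relation.Unary using (Pred; Decidable; _⊆_)
open import Relation.Unary.Properties using (_∩?_; ∁?; U?)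

open import Defs
open Extrema ℚ-totalOrder using (min≤⊤; ⊥≤max)

-- Case analysis with an explicit motive: it applies to an `if` that only appears after unfolding a
-- definition, where a `with` would find nothing to abstract.
if-elim : ∀ {A Q : Set} (P : A → Set) (d : Dec Q) {x y} →
          (Q → P x) → (¬ Q → P y) → P (if does d then x else y)
if-elim P (yes q) t f = t q
if-elim P (no ¬q) t f = f ¬q

-- Buckets

-- Otherwise q < ⌊q⌋ + 1 ≤ ⌊p⌋ ≤ p, contradicting p ≤ q; the chain below is this one with the
-- denominators cleared.
floor-mono : ∀ {p q} → p ℚ.≤ q → floor p ℤ.≤ floor q
floor-mono {p@record{}} {q@record{}} (*≤* p≤q) = ℤ.≮⇒≥ λ ⌊q⌋<⌊p⌋ →
  ℤ.<-irrefl refl (begin-strict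
    ℚ.↥ q ℤ.* ℚ.↧ p
      <⟨ ℤ.*-monoʳ-<-pos (ℚ.↧ p) (n<s[n/d]*d (ℚ.↥ q) (ℚ.↧ₙ q)) ⟩
    ℤ.suc (floor q) ℤ.* ℚ.↧ q ℤ.* ℚ.↧ p
      ≤⟨ ℤ.*-monoʳ-≤-nonNeg (ℚ.↧ p)
           (ℤ.*-monoʳ-≤-nonNeg (ℚ.↧ q) (ℤ.i<j⇒suc[i]≤j ⌊q⌋<⌊p⌋)) ⟩
    floor p ℤ.* ℚ.↧ q ℤ.* ℚ.↧ p
      ≡⟨ swap-* (floor p) (ℚ.↧ q) (ℚ.↧ p) ⟩
    floor p ℤ.* ℚ.↧ p ℤ.* ℚ.↧ q
      ≤⟨ ℤ.*-monoʳ-≤-nonNeg (ℚ.↧ q) (ℤ.[n/d]*d≤n (ℚ.↥ p) (ℚ.↧ p)) ⟩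
    ℚ.↥ p ℤ.* ℚ.↧ q
      ≤⟨ p≤q ⟩
    ℚ.↥ q ℤ.* ℚ.↧ p ∎)
  where
  open ℤ.≤-Reasoning
  swap-* : ∀ a b c → a ℤ.* b ℤ.* c ≡ a ℤ.* c ℤ.* b
  swap-* = ℤ-solve-∀
  n<s[n/d]*d : ∀ i d .{{_ : NonZero d}} → i ℤ.< ℤ.suc (i ℤ./ + d) ℤ.* + d
  n<s[n/d]*d i d@(suc _) = subst (λ j → i ℤ.< ℤ.suc j ℤ.* + d)
    (sym (ℤ.div-pos-is-/ℕ i d)) (ℤ.n<s[n/ℕd]*d i d)

floor-fromℕ : ∀ n → floor (fromℕ n) ≡ + n
floor-fromℕ n = trans (ℤ.div-pos-is-/ℕ (+ n) 1) (cong +_ (n/1≡n n))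

instance
  fromℕ-nonNegative : ∀ {n} → ℚ.NonNegative (fromℕ n)
  fromℕ-nonNegative = _

-- When `r` is 0 both quotients are 0 by convention. This case covers intervals of zero width and
-- the width computed for `k` = 1.
/₀-monoˡ-≤ : ∀ {p q} r → 0ℚ ℚ.≤ r → p ℚ.≤ q → p /₀ r ℚ.≤ q /₀ r
/₀-monoˡ-≤ r 0≤r p≤q with r ℚ.≟ 0ℚ
... | yes _   = ℚ.≤-refl
... | no  r≢0 = ℚ.*-monoʳ-≤-nonNeg ((ℚ.1/ r) {{ℚ.≢-nonZero r≢0}})
  {{ℚ.pos⇒nonNeg ((ℚ.1/ r) {{ℚ.≢-nonZero r≢0}}) {{ℚ.1/pos⇒pos r {{r>0}}}}}} p≤q
  where
  r>0 : ℚ.Positive r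
  r>0 = ℚ.nonNeg∧nonZero⇒pos r {{ℚ.nonNegative 0≤r}} {{ℚ.≢-nonZero r≢0}}

0/₀ : ∀ r → 0ℚ /₀ r ≡ 0ℚ
0/₀ r with r ℚ.≟ 0ℚ
... | yes _   = refl
... | no  r≢0 = ℚ.*-zeroˡ ((ℚ.1/ r) {{ℚ.≢-nonZero r≢0}})

*-/₀-cancelˡ : ∀ p q → p ≢ 0ℚ → (p ℚ.* q) /₀ p ≡ q
*-/₀-cancelˡ p q p≢0 with p ℚ.≟ 0ℚ
... | yes p≡0 = contradiction p≡0 p≢0
... | no  p≢0 = let instance _ = ℚ.≢-nonZero p≢0 in begin
  p ℚ.* q ℚ.* ℚ.1/ p    ≡⟨ cong (ℚ._* ℚ.1/ p) (ℚ.*-comm p q) ⟩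
  q ℚ.* p ℚ.* ℚ.1/ p    ≡⟨ ℚ.*-assoc q p (ℚ.1/ p) ⟩
  q ℚ.* (p ℚ.* ℚ.1/ p)  ≡⟨ cong (q ℚ.*_) (ℚ.*-inverseʳ p) ⟩
  q ℚ.* 1ℚ              ≡⟨ ℚ.*-identityʳ q ⟩
  q                     ∎
  where open ≡-Reasoning

p≤q⇒0≤q-p : ∀ {p q} → p ℚ.≤ q → 0ℚ ℚ.≤ q ℚ.- p
p≤q⇒0≤q-p {p} {q} p≤q =
  subst (ℚ._≤ q ℚ.- p) (ℚ.+-inverseʳ p) (ℚ.+-monoˡ-≤ (ℚ.- p) p≤q)

p<q⇒q-p≢0 : ∀ {p q} → p ℚ.< q → q ℚ.- p ≢ 0ℚ
p<q⇒q-p≢0 {p} {q} p<q q-p≡0 = ℚ.<-irrefl (sym q-p≡0)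
  (subst (ℚ._< q ℚ.- p) (ℚ.+-inverseʳ p) (ℚ.+-monoˡ-< (ℚ.- p) p<q))

module _ {lo hi : ℚ} where

  bucketIndex-mono : lo ℚ.≤ hi → ∀ k {x y} → x ℚ.≤ y →
                     bucketIndex lo hi k x ℤ.≤ bucketIndex lo hi k y
  bucketIndex-mono lo≤hi k x≤y =
    floor-mono (/₀-monoˡ-≤ (hi ℚ.- lo) (p≤q⇒0≤q-p lo≤hi)
      (ℚ.*-monoʳ-≤-nonNeg (fromℕ (k ∸ 1)) (ℚ.+-monoˡ-≤ (ℚ.- lo) x≤y)))

  -- Together with `bucketIndex-hi` and monotonicity, this places the ordinary indices between those
  -- of the two outer buckets.
  bucketIndex-lo : ∀ k → bucketIndex lo hi k lo ≡ + 0
  bucketIndex-lo k = cong floor (begin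
    ((lo ℚ.- lo) ℚ.* fromℕ (k ∸ 1)) /₀ (hi ℚ.- lo)
      ≡⟨ cong (λ z → (z ℚ.* fromℕ (k ∸ 1)) /₀ (hi ℚ.- lo)) (ℚ.+-inverseʳ lo) ⟩
    (0ℚ ℚ.* fromℕ (k ∸ 1)) /₀ (hi ℚ.- lo)
      ≡⟨ cong (_/₀ (hi ℚ.- lo)) (ℚ.*-zeroˡ (fromℕ (k ∸ 1))) ⟩
    0ℚ /₀ (hi ℚ.- lo)
      ≡⟨ 0/₀ (hi ℚ.- lo) ⟩
    0ℚ ∎)
    where open ≡-Reasoning

  bucketIndex-hi : lo ℚ.< hi → ∀ k → bucketIndex lo hi k hi ≡ + (k ∸ 1)
  bucketIndex-hi lo<hi k = trans
    (cong floor (*-/₀-cancelˡ (hi ℚ.- lo) (fromℕ (k ∸ 1)) (p<q⇒q-p≢0 lo<hi)))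
    (floor-fromℕ (k ∸ 1))

  -- Split on the zone of `x`, then on that of `y`. A lower zone for `y` contradicts `x ≤ y`, and
  -- the values at `lo` and `hi` compare the middle zone with the outer ones.
  approxBucketIndex-mono : lo ℚ.< hi → ∀ k {x y} → x ℚ.≤ y →
                           approxBucketIndex lo hi k x ℤ.≤ approxBucketIndex lo hi k y
  approxBucketIndex-mono lo<hi k {x} {y} x≤y =
    if-elim (ℤ._≤ approxBucketIndex lo hi k y) (x ℚ.<? lo)
      (λ _ → if-elim (+ 0 ℤ.≤_) (y ℚ.<? lo)
        (λ _ → ℤ.≤-refl)
        (λ y≮lo → if-elim (+ 0 ℤ.≤_) (hi ℚ.<? y)
          (λ _ → ℤ.+≤+ z≤n)
          (λ _ → ℤ.≤-trans (ℤ.+≤+ z≤n) (ℤ.suc-mono (0≤index (ℚ.≮⇒≥ y≮lo))))))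
      (λ x≮lo → if-elim (ℤ._≤ approxBucketIndex lo hi k y) (hi ℚ.<? x)
        (λ hi<x → if-elim (+ suc k ℤ.≤_) (y ℚ.<? lo)
          (λ y<lo → contradiction (ℚ.≤-<-trans x≤y y<lo) x≮lo)
          (λ _ → if-elim (+ suc k ℤ.≤_) (hi ℚ.<? y)
            (λ _ → ℤ.≤-refl)
            (λ hi≮y → contradiction (ℚ.<-≤-trans hi<x x≤y) hi≮y)))
        (λ hi≮x → if-elim (ℤ.suc (index x) ℤ.≤_) (y ℚ.<? lo)
          (λ y<lo → contradiction (ℚ.≤-<-trans x≤y y<lo) x≮lo)
          (λ _ → if-elim (ℤ.suc (index x) ℤ.≤_) (hi ℚ.<? y)
            (λ _ → ℤ.suc-mono (index≤k (ℚ.≮⇒≥ hi≮x)))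
            (λ _ → ℤ.suc-mono (bucketIndex-mono lo≤hi k x≤y)))))
    where
    lo≤hi = ℚ.<⇒≤ lo<hi
    index = bucketIndex lo hi k
    0≤index : lo ℚ.≤ y → + 0 ℤ.≤ index y
    0≤index lo≤y =
      subst (ℤ._≤ index y) (bucketIndex-lo k) (bucketIndex-mono lo≤hi k lo≤y)
    index≤k : x ℚ.≤ hi → index x ℤ.≤ + k
    index≤k x≤hi = ℤ.≤-trans
      (subst (index x ℤ.≤_) (bucketIndex-hi lo<hi k) (bucketIndex-mono lo≤hi k x≤hi))
      (ℤ.+≤+ (m∸n≤m k 1))

-- The invariant on bounds carried through the recursion: it makes bucket indices monotone, and
-- being weak it admits the zero-width intervals that arise when `k` = 1.
Ordered : ℚ × ℚ → Set
Ordered (lo , hi) = lo ℚ.≤ hi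

bucketBounds-ordered : ∀ {lo hi} → lo ℚ.≤ hi → ∀ k i → Ordered (bucketBounds lo hi k i)
bucketBounds-ordered {lo} {hi} lo≤hi k i = ℚ.+-monoʳ-≤ lo
  (ℚ.*-monoʳ-≤-nonNeg w {{ℚ.nonNegative 0≤w}} i≤1+i)
  where
  w = (hi ℚ.- lo) /₀ fromℕ (k ∸ 1)
  0≤w : 0ℚ ℚ.≤ w
  0≤w = subst (ℚ._≤ w) (0/₀ (fromℕ (k ∸ 1)))
    (/₀-monoˡ-≤ (fromℕ (k ∸ 1)) (ℚ.nonNegative⁻¹ _) (p≤q⇒0≤q-p lo≤hi))
  i≤1+i : fromℕ i ℚ.≤ fromℕ (suc i)
  i≤1+i = *≤* (ℤ.*-monoʳ-≤-nonNeg (+ 1) (ℤ.+≤+ (n≤1+n i)))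

approxBucketBounds-ordered : ∀ xs {lo hi} → lo ℚ.< hi → ∀ k i →
                             Ordered (approxBucketBounds xs lo hi k i)
approxBucketBounds-ordered xs lo<hi k zero    = min≤⊤ _ xs
approxBucketBounds-ordered xs lo<hi k (suc i) = if-elim Ordered (i ≟ k)
  (λ _ → ⊥≤max _ xs)
  (λ _ → bucketBounds-ordered (ℚ.<⇒≤ lo<hi) k i)

-- The witness comes from α = p / (1 + r) in lowest terms, where p ≤ r.
fraction-bound : ∀ {α} → 0ℚ ℚ.< α → α ℚ.< 1ℚ →
  ∃[ r ] (1 ≤ r × (∀ a b → fromℕ a ℚ.≤ α ℚ.* fromℕ b → a * suc r ≤ r * b))
fraction-bound {mkℚ (+ zero)  d-1 _} (*<* (ℤ.+<+ ())) _
fraction-bound {mkℚ (-[1+ _ ]) d-1 _} (*<* ()) _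
fraction-bound {α@(mkℚ (+ suc p) r _)} _ (*<* p<d) = r , ≤-trans (s≤s z≤n) p≤r , bound
  where
  p≤r : suc p ≤ r
  p≤r = s≤s⁻¹ (subst₂ _<_ (*-identityʳ (suc p)) (+-identityʳ (suc r)) (ℤ.drop‿+<+ p<d))
  bound : ∀ a b → fromℕ a ℚ.≤ α ℚ.* fromℕ b → a * suc r ≤ r * b
  bound a b a≤αb with ℚᵘ.≤-respʳ-≃ (ℚ.toℚᵘ-homo-* α (fromℕ b)) (ℚ.toℚᵘ-mono-≤ a≤αb)
  ... | ℚᵘ.*≤* le = ≤-trans (ℤ.drop‿+≤+ (subst₂ ℤ._≤_ lhs rhs le)) (*-monoˡ-≤ b p≤r)
    where
    lhs : + a ℤ.* + (suc r * 1) ≡ + (a * suc r)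
    lhs = trans (cong (λ d → + a ℤ.* + d) (*-identityʳ (suc r))) (sym (ℤ.pos-* a (suc r)))
    rhs : + suc p ℤ.* + b ℤ.* + 1 ≡ + (suc p * b)
    rhs = trans (ℤ.*-identityʳ (+ suc p ℤ.* + b)) (sym (ℤ.pos-* (suc p) b))

-- Depth of the recursion

*-swap : ∀ a b c → a * (b * c) ≡ b * (a * c)
*-swap = x∙yz≈y∙xz *-commutativeSemigroup

-- This is 1 + n/r ≤ (1 + 1/r)^n multiplied by r^(n+1).
Bernoulli : ∀ r n → (r + n) * r ^ n ≤ r * suc r ^ n
Bernoulli r zero    = ≤-reflexive (cong (_* 1) (+-identityʳ r))
Bernoulli r (suc n) = begin
  -- The added term makes the coefficient factor: (r + n + 1) r + n = (1 + r)(r + n).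
  (r + suc n) * (r * r ^ n)    ≤⟨ m≤m+n _ (n * r ^ n) ⟩
  (r + suc n) * (r * r ^ n) + n * r ^ n
                               ≡⟨ rearrange r n (r ^ n) ⟩
  suc r * ((r + n) * r ^ n)    ≤⟨ *-monoʳ-≤ (suc r) (Bernoulli r n) ⟩
  suc r * (r * suc r ^ n)      ≡⟨ *-swap (suc r) r (suc r ^ n) ⟩
  r * (suc r * suc r ^ n)      ∎
  where
  open ≤-Reasoning
  rearrange : ∀ r n x → (r + suc n) * (r * x) + n * x ≡ suc r * ((r + n) * x)
  rearrange = solve-∀

-- `Bernoulli` with exponent 1 + r, where already 1 + (1 + r)/r ≥ 2.
halving : ∀ r .{{_ : NonZero r}} → 2 * r ^ suc r ≤ suc r ^ suc r
halving r = *-cancelˡ-≤ r (begin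
  r * (2 * r ^ suc r)          ≡⟨ double r (r ^ suc r) ⟩
  (r + r) * r ^ suc r          ≤⟨ *-monoˡ-≤ (r ^ suc r) (+-monoʳ-≤ r (n≤1+n r)) ⟩
  (r + suc r) * r ^ suc r      ≤⟨ Bernoulli r (suc r) ⟩
  r * suc r ^ suc r            ∎)
  where
  open ≤-Reasoning
  double : ∀ r x → r * (2 * x) ≡ (r + r) * x
  double = solve-∀

n<2^[1+⌊log₂n⌋] : ∀ n → n < 2 ^ suc ⌊log₂ n ⌋
n<2^[1+⌊log₂n⌋] n = ≰⇒> λ 2^≤n → 1+n≰n
  (subst (_≤ ⌊log₂ n ⌋) (⌊log₂[2^n]⌋≡n (suc ⌊log₂ n ⌋)) (⌊log₂⌋-mono-≤ 2^≤n))

-- After d shrinkings by the factor r / (1 + r), a size m has dropped below 1.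
Exhausted : (r m d : ℕ) → Set
Exhausted r m d = m * r ^ d < suc r ^ d

-- Base case of the budget: once `d` is used up, no nonempty subarray remains to recurse on.
exhausted-0 : ∀ {r m} → Exhausted r m 0 → ¬ 1 ≤ m
exhausted-0 {m = m} m*1<1 1≤m = ≤⇒≯ 1≤m (subst (_< 1) (*-identityʳ m) m*1<1)

-- For pathological calls, which leave the budget `d` as it is.
exhausted-≤ : ∀ {r m m′} d → m′ ≤ m → Exhausted r m d → Exhausted r m′ d
exhausted-≤ {r} d m′≤m = ≤-<-trans (*-monoˡ-≤ (r ^ d) m′≤m)

-- For non-pathological calls, each of which spends one unit of the budget.
exhausted-shrink : ∀ {r m m′} d → m′ * suc r ≤ r * m →
                   Exhausted r m (suc d) → Exhausted r m′ d
exhausted-shrink {r} {m} {m′} d shrunk exhausted = *-cancelˡ-< (suc r) _ _ (begin-strict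
  suc r * (m′ * r ^ d)   ≡⟨ assoc-comm (suc r) m′ (r ^ d) ⟩
  m′ * suc r * r ^ d     ≤⟨ *-monoˡ-≤ (r ^ d) shrunk ⟩
  r * m * r ^ d          ≡⟨ rotate r m (r ^ d) ⟩
  m * (r * r ^ d)        <⟨ exhausted ⟩
  suc r * suc r ^ d      ∎)
  where
  open ≤-Reasoning
  assoc-comm : ∀ a b x → a * (b * x) ≡ b * a * x
  assoc-comm = solve-∀
  rotate : ∀ a b x → a * b * x ≡ b * (a * x)
  rotate = solve-∀

^-distribʳ-* : ∀ n a b → (a * b) ^ n ≡ a ^ n * b ^ n
^-distribʳ-* zero    a b = refl
^-distribʳ-* (suc n) a b =
  trans (cong (a * b *_) (^-distribʳ-* n a b)) (interchange *-commutativeSemigroup a b (a ^ n) (b ^ n))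

-- Each block of 1 + r shrinkings at least halves the size.
exhausted-log : ∀ r .{{_ : NonZero r}} m → Exhausted r m (suc r * suc ⌊log₂ m ⌋)
exhausted-log r m = begin-strict
  m * r ^ (suc r * ℓ)          ≡⟨ cong (m *_) (^-*-assoc r (suc r) ℓ) ⟨
  m * (r ^ suc r) ^ ℓ          <⟨ *-monoˡ-< ((r ^ suc r) ^ ℓ)
                                    {{m^n≢0 (r ^ suc r) ℓ {{m^n≢0 r (suc r)}}}}
                                    (n<2^[1+⌊log₂n⌋] m) ⟩
  2 ^ ℓ * (r ^ suc r) ^ ℓ      ≡⟨ ^-distribʳ-* ℓ 2 (r ^ suc r) ⟨
  (2 * r ^ suc r) ^ ℓ          ≤⟨ ^-monoˡ-≤ ℓ (halving r) ⟩
  (suc r ^ suc r) ^ ℓ          ≡⟨ ^-*-assoc (suc r) (suc r) ℓ ⟩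
  suc r ^ (suc r * ℓ)          ∎
  where
  open ≤-Reasoning
  ℓ = suc ⌊log₂ m ⌋

-- Inversions and insertion sort

module _ {A : Set} where

  length-filter-disjoint : ∀ {P Q R : Pred A 0ℓ}
    (P? : Decidable P) (Q? : Decidable Q) (R? : Decidable R) →
    P ⊆ R → Q ⊆ R → (∀ {x} → P x → ¬ Q x) → ∀ xs →
    length (filter P? xs) + length (filter Q? xs) ≤ length (filter R? xs)
  length-filter-disjoint P? Q? R? P⊆R Q⊆R disjoint [] = z≤n
  length-filter-disjoint P? Q? R? P⊆R Q⊆R disjoint (x ∷ xs)
    with ih ← length-filter-disjoint P? Q? R? P⊆R Q⊆R disjoint xs
    with P? x | Q? x | R? x
  ... | yes Px | yes Qx | _      = contradiction Qx (disjoint Px)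
  ... | yes Px | no  _  | no ¬Rx = contradiction (P⊆R Px) ¬Rx
  ... | no  _  | yes Qx | no ¬Rx = contradiction (Q⊆R Qx) ¬Rx
  ... | yes _  | no  _  | yes _  = s≤s ih
  ... | no  _  | yes _  | yes _  = ≤-trans (≤-reflexive (+-suc _ _)) (s≤s ih)
  ... | no  _  | no  _  | yes _  = m≤n⇒m≤1+n ih
  ... | no  _  | no  _  | no  _  = ih

  -- The induction replaces `R` by its part outside the first class, which by disjointness still
  -- contains all the other classes.
  sum-length-filter : ∀ {k} {P : Fin k → Pred A 0ℓ} {R : Pred A 0ℓ}
    (P? : ∀ i → Decidable (P i)) (R? : Decidable R) →
    (∀ i → P i ⊆ R) → (∀ i j {x} → P i x → P j x → i ≡ j) → ∀ xs →
    sum (tabulate λ i → length (filter (P? i) xs)) ≤ length (filter R? xs)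
  sum-length-filter {zero}      P? R? P⊆R unique xs = z≤n
  sum-length-filter {suc k} {P} P? R? P⊆R unique xs = begin
    length (filter (P? zero) xs) + sum (tabulate λ i → length (filter (P? (suc i)) xs))
      ≤⟨ +-monoʳ-≤ (length (filter (P? zero) xs))
           (sum-length-filter (P? ∘ suc) rest? (λ i Px → P⊆R (suc i) Px , P₀-disjoint i Px)
             (λ i j Px Px′ → Fin.suc-injective (unique (suc i) (suc j) Px Px′)) xs) ⟩
    length (filter (P? zero) xs) + length (filter rest? xs)
      ≤⟨ length-filter-disjoint (P? zero) rest? R? (P⊆R zero) proj₁
           (λ P₀x Rx → proj₂ Rx P₀x) xs ⟩
    length (filter R? xs) ∎
    where
    open ≤-Reasoning
    rest? = R? ∩? ∁? (P? zero)
    P₀-disjoint : ∀ i {x} → P (suc i) x → ¬ P zero x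
    P₀-disjoint i Px P₀x with () ← unique zero (suc i) P₀x Px

  -- The single pair `x`, `y` moves from one count to the other; this is the exchange of counting
  -- order behind `crossings-∷`.
  length-filter-swap : ∀ {R : A → A → Set} (R? : ∀ x y → Dec (R x y)) x y xs ys →
    length (filter (R? x) (y ∷ xs)) + length (filter (λ z → R? z y) ys) ≡
    length (filter (λ z → R? z y) (x ∷ ys)) + length (filter (R? x) xs)
  length-filter-swap R? x y xs ys with R? x y
  ... | yes _ = cong suc (+-comm (length (filter (R? x) xs)) _)
  ... | no  _ = +-comm (length (filter (R? x) xs)) _

≤⇒≯ℚ : ∀ {p q} → p ℚ.≤ q → ¬ q ℚ.< p
≤⇒≯ℚ p≤q q<p = ℚ.<-irrefl refl (ℚ.≤-<-trans p≤q q<p)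

inversions : List ℚ → ℕ
inversions []       = 0
inversions (x ∷ xs) = length (filter (ℚ._<? x) xs) + inversions xs

inversions-sorted : ∀ {xs} → AllPairs ℚ._≤_ xs → inversions xs ≡ 0
inversions-sorted []                       = refl
inversions-sorted {x ∷ _} (x≤xs ∷ sorted) = cong₂ _+_
  (cong length (List.filter-none (ℚ._<? x) (All.map ≤⇒≯ℚ x≤xs)))
  (inversions-sorted sorted)

-- Each entry is followed by fewer than `s` others. This bounds what the buckets of size at most `S`
-- leave to insertion sort.
inversions-short : ∀ {s} xs → length xs ≤ s → inversions xs ≤ length xs * s
inversions-short []       _      = z≤n
inversions-short (x ∷ xs) |xs|<s = +-mono-≤
  (≤-trans (List.length-filter (ℚ._<? x) xs) (<⇒≤ |xs|<s))
  (inversions-short xs (<⇒≤ |xs|<s))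

-- No inversion crosses the boundary. The order is assumed between predicates because `Outcome`
-- describes the entries of a result by a predicate.
inversions-++ : ∀ {P Q : Pred ℚ 0ℓ} {xs ys} → (∀ {x y} → P x → Q y → x ℚ.≤ y) →
                All P xs → All Q ys →
                inversions (xs ++ ys) ≡ inversions xs + inversions ys
inversions-++ P≤Q [] Qys = refl
inversions-++ {xs = x ∷ xs} {ys} P≤Q (Px ∷ Pxs) Qys = begin
  length (filter (ℚ._<? x) (xs ++ ys)) + inversions (xs ++ ys)
    ≡⟨ cong₂ _+_ (cong length no-cross) (inversions-++ P≤Q Pxs Qys) ⟩
  length (filter (ℚ._<? x) xs) + (inversions xs + inversions ys)
    ≡⟨ +-assoc (length (filter (ℚ._<? x) xs)) (inversions xs) (inversions ys) ⟨
  length (filter (ℚ._<? x) xs) + inversions xs + inversions ys ∎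
  where
  open ≡-Reasoning
  no-cross : filter (ℚ._<? x) (xs ++ ys) ≡ filter (ℚ._<? x) xs
  no-cross = trans (List.filter-++ (ℚ._<? x) xs ys)
    (trans (cong (filter (ℚ._<? x) xs ++_)
             (List.filter-none (ℚ._<? x) (All.map (λ Qy → ≤⇒≯ℚ (P≤Q Px Qy)) Qys)))
           (List.++-identityʳ _))

insert-↭ : ∀ x ys → value (insert x ys) ↭ x ∷ ys
insert-↭ x []       = ↭-refl
insert-↭ x (y ∷ ys) = if-elim (λ m → value m ↭ x ∷ y ∷ ys) (x ℚ.<? y)
  (λ _ → ↭-trans (prep y (insert-↭ x ys)) (swap y x ↭-refl))
  (λ _ → ↭-refl)

-- Insertion stops at the first entry that is ≤ x, so every entry it passes is
-- counted on the right, whether or not the prefix is sorted.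
insert-time : ∀ x ys → time (insert x ys) ≤ 2 + 2 * length (filter (x ℚ.<?_) ys)
insert-time x []       = s≤s z≤n
insert-time x (y ∷ ys) = s≤s (if-elim (λ m → time m ≤ suc (2 * length (filter (x ℚ.<?_) (y ∷ ys))))
  (x ℚ.<? y)
  (λ x<y → subst (λ zs → suc (time (insert x ys) + 0) ≤ suc (2 * length zs)) (sym (List.filter-accept (x ℚ.<?_) x<y))
    (s≤s (subst₂ _≤_ (sym (+-identityʳ _)) (2+2* _) (insert-time x ys))))
  (λ _ → s≤s z≤n))
  where
  2+2* : ∀ n → 2 + 2 * n ≡ 2 * suc n
  2+2* = solve-∀

crossings : (prefix xs : List ℚ) → ℕ
crossings prefix []       = 0
crossings prefix (x ∷ xs) = length (filter (x ℚ.<?_) prefix) + crossings prefix xs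

crossings-[] : ∀ xs → crossings [] xs ≡ 0
crossings-[] []       = refl
crossings-[] (x ∷ xs) = crossings-[] xs

crossings-↭ : ∀ {ps qs} xs → ps ↭ qs → crossings ps xs ≡ crossings qs xs
crossings-↭ []       ps↭qs = refl
crossings-↭ (x ∷ xs) ps↭qs =
  cong₂ _+_ (↭-length (filter-↭ (x ℚ.<?_) ps↭qs)) (crossings-↭ xs ps↭qs)

crossings-∷ : ∀ p ps xs → crossings (p ∷ ps) xs ≡
              length (filter (ℚ._<? p) xs) + crossings ps xs
crossings-∷ p ps []       = refl
crossings-∷ p ps (x ∷ xs) = begin
  length (filter (x ℚ.<?_) (p ∷ ps)) + crossings (p ∷ ps) xs
    ≡⟨ cong (_+_ (length (filter (x ℚ.<?_) (p ∷ ps)))) (crossings-∷ p ps xs) ⟩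
  length (filter (x ℚ.<?_) (p ∷ ps)) + (length (filter (ℚ._<? p) xs) + crossings ps xs)
    ≡⟨ +-assoc (length (filter (x ℚ.<?_) (p ∷ ps))) _ (crossings ps xs) ⟨
  length (filter (x ℚ.<?_) (p ∷ ps)) + length (filter (ℚ._<? p) xs) + crossings ps xs
    ≡⟨ cong (λ e → e + crossings ps xs) (length-filter-swap ℚ._<?_ x p ps xs) ⟩
  length (filter (ℚ._<? p) (x ∷ xs)) + length (filter (x ℚ.<?_) ps) + crossings ps xs
    ≡⟨ +-assoc (length (filter (ℚ._<? p) (x ∷ xs))) _ (crossings ps xs) ⟩
  length (filter (ℚ._<? p) (x ∷ xs)) + (length (filter (x ℚ.<?_) ps) + crossings ps xs) ∎
  where open ≡-Reasoning

-- `inversions xs + crossings ps xs` is a potential. Inserting `x` uses up its crossings with the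
-- prefix, which pay for the comparisons, while its inversions with later entries become crossings
-- of the new prefix.
insertAll-time : ∀ ps xs → time (insertAll ps xs) ≤
                 2 * length xs + 2 * (inversions xs + crossings ps xs)
insertAll-time ps []       = z≤n
insertAll-time ps (x ∷ xs) = begin
  time (insert x ps) + time (insertAll ps′ xs)
    ≤⟨ +-mono-≤ (insert-time x ps) (insertAll-time ps′ xs) ⟩
  2 + 2 * a + (2 * length xs + 2 * (inversions xs + crossings ps′ xs))
    ≡⟨ cong (λ e → 2 + 2 * a + (2 * length xs + 2 * (inversions xs + e)))
         (trans (crossings-↭ xs (insert-↭ x ps)) (crossings-∷ x ps xs)) ⟩
  2 + 2 * a + (2 * length xs + 2 * (inversions xs + (b + crossings ps xs)))
    ≡⟨ rearrange a (length xs) (inversions xs) b (crossings ps xs) ⟩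
  2 * suc (length xs) + 2 * (b + inversions xs + (a + crossings ps xs)) ∎
  where
  open ≤-Reasoning
  ps′ = value (insert x ps)
  a = length (filter (x ℚ.<?_) ps)
  b = length (filter (ℚ._<? x) xs)
  rearrange : ∀ a l i b c → 2 + 2 * a + (2 * l + 2 * (i + (b + c))) ≡
                            2 * suc l + 2 * (b + i + (a + c))
  rearrange = solve-∀

insertionSort-time : ∀ xs → time (insertionSort xs) ≤ 2 * length xs + 2 * inversions xs
insertionSort-time xs = subst (λ e → time (insertionSort xs) ≤ 2 * length xs + 2 * e)
  (trans (cong (_+_ (inversions xs)) (crossings-[] xs)) (+-identityʳ (inversions xs)))
  (insertAll-time [] xs)

-- Asymptotic bounds

∈O-+ : ∀ {f g h} → f ∈O h → g ∈O h → (λ n → f n + g n) ∈O h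
∈O-+ {f} {g} {h} (C , N , f≤) (D , M , g≤) = C + D , N + M , λ n N+M≤n → begin
  f n + g n            ≤⟨ +-mono-≤ (f≤ n (≤-trans (m≤m+n N M) N+M≤n))
                                   (g≤ n (≤-trans (m≤n+m M N) N+M≤n)) ⟩
  C * h n + D * h n    ≡⟨ *-distribʳ-+ (h n) C D ⟨
  (C + D) * h n        ∎
  where open ≤-Reasoning

∈O-trans : ∀ {f g h} → f ∈O g → g ∈O h → f ∈O h
∈O-trans {f} {g} {h} (C , N , f≤) (D , M , g≤) = C * D , N + M , λ n N+M≤n → begin
  f n                  ≤⟨ f≤ n (≤-trans (m≤m+n N M) N+M≤n) ⟩
  C * g n              ≤⟨ *-monoʳ-≤ C (g≤ n (≤-trans (m≤n+m M N) N+M≤n)) ⟩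
  C * (D * h n)        ≡⟨ *-assoc C D (h n) ⟨
  C * D * h n          ∎
  where open ≤-Reasoning

∈O-scaleˡ : ∀ {f g} a → f ∈O g → (λ n → a * f n) ∈O g
∈O-scaleˡ {f} a = ∈O-trans {g = f} (a , 0 , λ n _ → ≤-refl)

∈O-scaleʳ : ∀ {f g} a → f ∈O g → (λ n → f n * a) ∈O g
∈O-scaleʳ {f} a = ∈O-trans {g = f} (a , 0 , λ n _ → ≤-reflexive (*-comm (f n) a))

∈O-n* : ∀ {f g} → f ∈O g → (λ n → n * f n) ∈O (λ n → n * g n)
∈O-n* {f} {g} (C , N , f≤) = C , N , λ n N≤n →
  ≤-trans (*-monoʳ-≤ n (f≤ n N≤n)) (≤-reflexive (*-swap n C (g n)))

log∈Olog : ⌊log₂_⌋ ∈O ⌊log₂_⌋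
log∈Olog = 1 , 0 , λ n _ → ≤-reflexive (sym (*-identityˡ ⌊log₂ n ⌋))

constant∈Olog : ∀ a → (λ _ → a) ∈O ⌊log₂_⌋
-- The threshold is 2, where `⌊log₂_⌋` first reaches 1.
constant∈Olog a = a , 2 , λ n 2≤n →
  subst (_≤ a * ⌊log₂ n ⌋) (*-identityʳ a) (*-monoʳ-≤ a (⌊log₂⌋-mono-≤ 2≤n))

id∈Onlog : id ∈O (λ n → n * ⌊log₂ n ⌋)
id∈Onlog = ∈O-trans {g = λ n → n * 1} (1 , 0 , λ n _ → ≤-reflexive (n≡1*[n*1] n))
  (∈O-n* (constant∈Olog 1))
  where
  n≡1*[n*1] : ∀ n → n ≡ 1 * (n * 1)
  n≡1*[n*1] = solve-∀

bounded-below : ∀ (f : ℕ → ℕ) N → ∃[ B ] (∀ n → n < N → f n ≤ B)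
bounded-below f zero    = 0 , λ _ ()
bounded-below f (suc N) = let B , f≤B = bounded-below f N in B + f N , λ n n<1+N →
  [ (λ n<N → ≤-trans (f≤B n n<N) (m≤m+n B (f N)))
  , (λ { refl → m≤n+m (f N) B })
  ]′ (m<1+n⇒m<n∨m≡n n<1+N)

-- The recursion may meet sizes below the threshold `N`; the constant `B` absorbs their costs.
∈O⇒≤ : ∀ {f g} → f ∈O g → ∃[ C ] ∃[ B ] (∀ n → f n ≤ C * g n + B)
∈O⇒≤ {f} {g} (C , N , f≤) = let B , f≤B = bounded-below f N in C , B , λ n →
  [ (λ n<N → ≤-trans (f≤B n n<N) (m≤n+m B (C * g n)))
  , (λ N≤n → ≤-trans (f≤ n N≤n) (m≤m+n (C * g n) B))
  ]′ (<-≤-connex n N)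

Cn+B≤n[C+B] : ∀ {n} C B → 1 ≤ n → C * n + B ≤ n * (C + B)
Cn+B≤n[C+B] {n} C B 1≤n = begin
  C * n + B        ≤⟨ +-monoʳ-≤ (C * n) (m≤n*m B n {{>-nonZero 1≤n}}) ⟩
  C * n + n * B    ≡⟨ cong (λ e → e + n * B) (*-comm C n) ⟩
  n * C + n * B    ≡⟨ *-distribˡ-+ n C B ⟨
  n * (C + B)      ∎
  where open ≤-Reasoning

-- A nonempty subarray can pay the additive constant as a cost per element, a form that adds up over
-- disjoint buckets.
∈O-linear : ∀ {f} → f ∈O id → ∃[ A ] (∀ n → 1 ≤ n → f n ≤ n * A)
∈O-linear f∈O = let C , B , f≤ = ∈O⇒≤ f∈O in
  C + B , λ n 1≤n → ≤-trans (f≤ n) (Cn+B≤n[C+B] C B 1≤n)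

-- The recursion

-- A run on n elements satisfying P that costs at most b per element and leaves
-- at most s inversions per element.
record Outcome (s b n : ℕ) (P : Pred ℚ 0ℓ) (run : Timed (List ℚ)) : Set where
  field
    time-≤       : time run ≤ n * b
    length-≤     : length (value run) ≤ n
    inversions-≤ : inversions (value run) ≤ n * s
    all          : All P (value run)

open Outcome

outcome-weaken : ∀ {s b n n′ P Q run} → n ≤ n′ → P ⊆ Q →
                 Outcome s b n P run → Outcome s b n′ Q run
outcome-weaken {s} {b} n≤n′ P⊆Q o = record
  { time-≤       = ≤-trans (time-≤ o) (*-monoˡ-≤ b n≤n′)
  ; length-≤     = ≤-trans (length-≤ o) n≤n′
  ; inversions-≤ = ≤-trans (inversions-≤ o) (*-monoˡ-≤ s n≤n′)
  ; all          = All.map P⊆Q (all o)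
  }

outcome-spend : ∀ {s a b n P t run} → t ≤ n * a →
                Outcome s b n P run → Outcome s (a + b) n P (spend t >> run)
outcome-spend {a = a} {b} {n} {t = t} {run} t≤ o = record
  { time-≤       = ≤-trans (+-mono-≤ t≤ (time-≤ o)) (≤-reflexive (sym (*-distribˡ-+ n a b)))
  ; length-≤     = length-≤ o
  ; inversions-≤ = inversions-≤ o
  ; all          = all o
  }

outcome-slower : ∀ {s b b′ n P run} → b ≤ b′ →
                 Outcome s b n P run → Outcome s b′ n P run
outcome-slower {n = n} b≤b′ o = record
  { time-≤       = ≤-trans (time-≤ o) (*-monoʳ-≤ n b≤b′)
  ; length-≤     = length-≤ o
  ; inversions-≤ = inversions-≤ o
  ; all          = all o
  }

outcome-return : ∀ {s b P} xs → inversions xs ≤ length xs * s → All P xs →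
                 Outcome s b (length xs) P (return xs)
outcome-return xs inv≤ Pxs = record
  { time-≤ = z≤n ; length-≤ = ≤-refl ; inversions-≤ = inv≤ ; all = Pxs }

-- The rates `s` and `b` are common to all buckets, so the bounds add up; separated predicates
-- exclude inversions between buckets.
forBuckets-outcome : ∀ {s b k} {n : Fin k → ℕ} {P : Fin k → Pred ℚ 0ℓ} {f} →
  (∀ i j {x y} → toℕ i < toℕ j → P i x → P j y → x ℚ.≤ y) →
  (∀ i → Outcome s b (n i) (P i) (f i)) →
  Outcome s b (sum (tabulate n)) (λ x → ∃[ i ] P i x) (forBuckets f)
forBuckets-outcome {k = zero} P≤P o =
  record { time-≤ = z≤n ; length-≤ = z≤n ; inversions-≤ = z≤n ; all = [] }
forBuckets-outcome {s} {b} {suc k} {n} {P} {f} P≤P o = record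
  { time-≤ = begin
      time (f zero) + (time rest + 0)
        ≡⟨ cong (_+_ (time (f zero))) (+-identityʳ (time rest)) ⟩
      time (f zero) + time rest
        ≤⟨ +-mono-≤ (time-≤ (o zero)) (time-≤ ih) ⟩
      n zero * b + total * b
        ≡⟨ *-distribʳ-+ b (n zero) total ⟨
      (n zero + total) * b ∎
  ; length-≤ = begin
      length (value (f zero) ++ value rest)
        ≡⟨ List.length-++ (value (f zero)) ⟩
      length (value (f zero)) + length (value rest)
        ≤⟨ +-mono-≤ (length-≤ (o zero)) (length-≤ ih) ⟩
      n zero + total ∎
  ; inversions-≤ = begin
      inversions (value (f zero) ++ value rest)
        ≡⟨ inversions-++ (λ { Px (j , Py) → P≤P zero (suc j) z<s Px Py })
             (all (o zero)) (all ih) ⟩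
      inversions (value (f zero)) + inversions (value rest)
        ≤⟨ +-mono-≤ (inversions-≤ (o zero)) (inversions-≤ ih) ⟩
      n zero * s + total * s
        ≡⟨ *-distribʳ-+ s (n zero) total ⟨
      (n zero + total) * s ∎
  ; all = All.++⁺ (All.map (λ Px → zero , Px) (all (o zero)))
                  (All.map (λ { (i , Px) → suc i , Px }) (all ih))
  }
  where
  open ≤-Reasoning
  rest  = forBuckets (f ∘ suc)
  total = sum (tabulate (n ∘ suc))
  ih    = forBuckets-outcome (λ i j i<j → P≤P (suc i) (suc j) (s<s i<j)) (o ∘ suc)

-- Costs per element in the recursive core

module Analysis (impl : Implementation) where

  open Implementation impl
  open NFSSort impl
  open Scattered

  distributionCost : ℕ → (ℚ → ℤ) → List ℚ → ℕ
  distributionCost k index xs = scatterCost k index xs + bookkeepingCost k xs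

  ∃-distributionCost-linear : ∃[ A ] (∀ k index xs → k ≤ 2 + buckets (length xs) →
    1 ≤ length xs → distributionCost k index xs ≤ length xs * A)
  ∃-distributionCost-linear =
    let T , scatter≤ , T∈O = scatterCost-O
        A , T≤ = ∈O-linear T∈O
        U , V , bookkeeping≤ , U∈O , V∈O = bookkeepingCost-O
        B , U≤ = ∈O-linear U∈O
        -- At most 2 + `Kmax` buckets occur, so the cost in `k` is bounded by a constant; the bound
        -- ranges over `k` < 3 + `Kmax`.
        C , V≤ = bounded-below V (3 + Kmax)
    in A + (B + C) , λ k index xs k≤ 1≤m →
      let m = length xs in begin
      scatterCost k index xs + bookkeepingCost k xs
        ≤⟨ +-mono-≤ (≤-trans (scatter≤ k index xs k≤) (T≤ m 1≤m)) (begin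
             bookkeepingCost k xs
               ≤⟨ bookkeeping≤ k xs ⟩
             U m + V k
               ≤⟨ +-mono-≤ (U≤ m 1≤m)
                    (V≤ k (s≤s (≤-trans k≤ (+-monoʳ-≤ 2 (buckets≤Kmax m))))) ⟩
             m * B + C
               ≤⟨ +-monoʳ-≤ (m * B) (m≤n*m C m {{>-nonZero 1≤m}}) ⟩
             m * B + m * C
               ≡⟨ *-distribˡ-+ m B C ⟨
             m * (B + C) ∎) ⟩
      m * A + m * (B + C)
        ≡⟨ *-distribˡ-+ m A (B + C) ⟨
      m * (A + (B + C)) ∎
    where open ≤-Reasoning

  ∃-equalityCheckCost-linear : ∃[ A ] (∀ xs → 1 ≤ length xs →
    equalityCheckCost xs ≤ length xs * A)
  ∃-equalityCheckCost-linear =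
    let T , check≤ , T∈O = equalityCheckCost-O
        A , T≤ = ∈O-linear T∈O
    in A , λ xs 1≤m → ≤-trans (check≤ xs) (T≤ (length xs) 1≤m)

  -- Replacing log q by log n gives all fallback sorts one common rate, with `C` and `B` chosen
  -- before `n`.
  ∃-fallbackCost-log : ∃[ C ] ∃[ B ] (∀ n ys → 1 ≤ length ys → length ys ≤ n →
    fallbackCost ys ≤ length ys * (C * ⌊log₂ n ⌋ + B))
  ∃-fallbackCost-log =
    let T , fallback≤ , T∈O = fallbackCost-O
        C , B , T≤ = ∈O⇒≤ T∈O
    in C , B , λ n ys 1≤q q≤n → let q = length ys in begin
      fallbackCost ys              ≤⟨ ≤-trans (fallback≤ ys) (T≤ q) ⟩
      C * (q * ⌊log₂ q ⌋) + B
        ≤⟨ +-mono-≤ (*-monoʳ-≤ C (*-monoʳ-≤ q (⌊log₂⌋-mono-≤ q≤n)))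
                    (m≤n*m B q {{>-nonZero 1≤q}}) ⟩
      C * (q * ⌊log₂ n ⌋) + q * B  ≡⟨ cong (λ e → e + q * B) (*-swap C q ⌊log₂ n ⌋) ⟩
      q * (C * ⌊log₂ n ⌋) + q * B  ≡⟨ *-distribˡ-+ q (C * ⌊log₂ n ⌋) B ⟨
      q * (C * ⌊log₂ n ⌋ + B)      ∎
    where open ≤-Reasoning

  region-all : ∀ {k index xs} (σ : Scattered k index xs) {P : Pred ℚ 0ℓ} → All P xs →
               ∀ i → All (λ x → P x × index x ≡ + toℕ i) (region σ i)
  region-all {index = index} {xs} σ Pxs i = All-resp-↭ (↭-sym (region-↭ σ i))
    (All.zip (All.filter⁺ index≟i Pxs , All.all-filter index≟i xs))
    where index≟i = λ x → index x ℤ.≟ + toℕ i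

  -- Every entry has a single index, so regions are disjoint. Entries whose index is outside {0,
  -- ..., k - 1} lie in no region, hence an inequality.
  sum-region-length : ∀ {k index xs} (σ : Scattered k index xs) →
                      sum (tabulate (length ∘ region σ)) ≤ length xs
  sum-region-length {k} {index} {xs} σ = begin
    sum (tabulate (length ∘ region σ))
      ≡⟨ cong sum (List.tabulate-cong (λ i → ↭-length (region-↭ σ i))) ⟩
    sum (tabulate {n = k} λ i → length (filter (λ x → index x ℤ.≟ + toℕ i) xs))
      ≤⟨ sum-length-filter {k = k} (λ i x → index x ℤ.≟ + toℕ i) U? (λ _ _ → tt)
           (λ i j ≡i ≡j → Fin.toℕ-injective (ℤ.+-injective (trans (sym ≡i) ≡j))) xs ⟩
    length (filter U? xs)
      ≤⟨ List.length-filter U? xs ⟩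
    length xs ∎
    where open ≤-Reasoning

  module Recursion
    {A E : ℕ}
    (distribution≤ : ∀ k index xs → k ≤ 2 + buckets (length xs) → 1 ≤ length xs →
                     distributionCost k index xs ≤ length xs * A)
    (equalityCheck≤ : ∀ xs → 1 ≤ length xs → equalityCheckCost xs ≤ length xs * E)
    {r : ℕ}
    (α≤r/[1+r] : ∀ a b → fromℕ a ℚ.≤ α ℚ.* fromℕ b → a * suc r ≤ r * b)
    {n F : ℕ}
    (fallback≤ : ∀ ys → 1 ≤ length ys → length ys ≤ n → fallbackCost ys ≤ length ys * F)
    where

    -- Rate for at most `μ` nested calls: each charges `E` for the equality check and `A` for
    -- distribution. `F` enters once, since nothing recurses inside a fallback sort.
    level : ℕ → ℕ
    level μ = μ * (E + A) + F

    level-mono : ∀ {μ ν} → μ ≤ ν → level μ ≤ level ν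
    level-mono μ≤ν = +-monoˡ-≤ F (*-monoˡ-≤ (E + A) μ≤ν)

    mutual

      -- The termination measure is reused with the budget `d` in place of the size:
      -- `measure d counter` bounds the number of nested calls still possible. The call's own
      -- `E + A` accounts for the `suc`. The induction follows the accessibility proof `wf`, as
      -- `core` does.
      core-outcome : ∀ {P} d xs bounds counter wf → Exhausted r (length xs) d →
        1 ≤ length xs → length xs ≤ n → Ordered bounds → All P xs →
        Outcome S (level (suc (measure d counter))) (length xs) P
          (core xs bounds counter wf)
      core-outcome {P} d xs (lo , hi) counter wf exhausted 1≤m m≤n lo≤hi Pxs =
        outcome-slower (≤-reflexive (E+[A+level] E A (measure d counter) F))
          (outcome-spend {a = E} (equalityCheck≤ xs 1≤m)
            (if-elim (Outcome S (A + level (measure d counter)) (length xs) P)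
              (allPairs? ℚ._≟_ xs)
              (λ equal → outcome-return xs
                (subst (_≤ length xs * S)
                  (sym (inversions-sorted (AllPairs.map ℚ.≤-reflexive equal))) z≤n) Pxs)
              (λ _ → distribute-outcome d xs k (bucketIndex lo hi k) (bucketBounds lo hi k)
                counter wf exhausted 1≤m m≤n (m≤n+m k 2) (bucketIndex-mono lo≤hi k)
                (bucketBounds-ordered lo≤hi k) Pxs)))
        where
        k = buckets (length xs)
        E+[A+level] : ∀ E A μ F → E + (A + (μ * (E + A) + F)) ≡ suc μ * (E + A) + F
        E+[A+level] = solve-∀

      distribute-outcome : ∀ {P} d xs k index bounds counter wf →
        Exhausted r (length xs) d → 1 ≤ length xs → length xs ≤ n →
        k ≤ 2 + buckets (length xs) →
        (∀ {x y} → x ℚ.≤ y → index x ℤ.≤ index y) →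
        (∀ i → Ordered (bounds i)) → All P xs →
        Outcome S (A + level (measure d counter)) (length xs) P
          (distribute xs k index bounds counter wf)
      distribute-outcome {P} d xs k index bounds counter wf exhausted 1≤m m≤n k≤
        index-mono bounds-ordered Pxs =
        subst (Outcome S (A + level (measure d counter)) (length xs) P) spend-assoc
          (outcome-spend {a = A} (distribution≤ k index xs k≤ 1≤m)
            (outcome-weaken (sum-region-length σ) (proj₁ ∘ proj₂)
              (forBuckets-outcome buckets-ordered λ i →
                treat-outcome d (region σ i) (bounds (toℕ i)) (region-length σ i) wf
                  (treatment (length (region σ i)) (length xs) counter)
                  exhausted m≤n (bounds-ordered (toℕ i)) (region-all σ Pxs i))))
        where
        σ = scatter k index xs
        spend-assoc : ∀ {run : Timed (List ℚ)} →
          (spend (distributionCost k index xs) >> run) ≡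
          (spend (scatterCost k index xs) >> (spend (bookkeepingCost k xs) >> run))
        spend-assoc {run} = cong (value run after_)
          (+-assoc (scatterCost k index xs) (bookkeepingCost k xs) (time run))
        buckets-ordered : ∀ i j {x y} → toℕ {k} i < toℕ {k} j →
          P x × index x ≡ + toℕ i → P y × index y ≡ + toℕ j → x ℚ.≤ y
        -- If y < x, monotonicity of the index would give j ≤ i.
        buckets-ordered i j i<j (_ , x≡i) (_ , y≡j) = ℚ.≮⇒≥ λ y<x →
          ≤⇒≯ (ℤ.drop‿+≤+ (subst₂ ℤ._≤_ y≡j x≡i (index-mono (ℚ.<⇒≤ y<x)))) i<j

      treat-outcome : ∀ {P m counter} d ys bounds ys≤m wf treatment →
        Exhausted r m d → m ≤ n → Ordered bounds → All P ys →
        Outcome S (level (measure d counter)) (length ys) P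
          (treat {m} {counter} ys bounds ys≤m wf treatment)
      treat-outcome d ys bounds ys≤m wf (leave ≤S) _ _ _ Pys =
        outcome-return ys (inversions-short ys ≤S) Pys
      treat-outcome {m = m} zero ys bounds ys≤m (acc rs) (recurse S< ≤αm) exhausted m≤n ordered Pys =
        contradiction (≤-trans (≤-trans (s≤s z≤n) S<) ys≤m) (exhausted-0 {r} {m} exhausted)
      treat-outcome {m = m} {counter} (suc d) ys bounds ys≤m (acc rs) (recurse S< ≤αm)
        exhausted m≤n ordered Pys =
        outcome-slower (level-mono (measure-recurse counter (n<1+n d)))
          (core-outcome d ys bounds 0 _
            (exhausted-shrink {r} {m} {length ys} d (α≤r/[1+r] _ _ ≤αm) exhausted)
            (≤-trans (s≤s z≤n) S<) (≤-trans ys≤m m≤n) ordered Pys)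
      treat-outcome {m = m} {counter} d ys bounds ys≤m (acc rs) (recurse⁺ S< _ counter<c)
        exhausted m≤n ordered Pys =
        outcome-slower (level-mono (measure-recurse⁺ (≤-refl {d}) counter<c))
          (core-outcome d ys bounds (suc counter) _ (exhausted-≤ {r} {m} {length ys} d ys≤m exhausted)
            (≤-trans (s≤s z≤n) S<) (≤-trans ys≤m m≤n) ordered Pys)
      treat-outcome {counter = counter} d ys bounds ys≤m wf (fall-back S< _ _)
        _ m≤n _ Pys = record
        { time-≤ = begin
            fallbackCost ys + 0
              ≡⟨ +-identityʳ (fallbackCost ys) ⟩
            fallbackCost ys
              ≤⟨ fallback≤ ys (≤-trans (s≤s z≤n) S<) (≤-trans ys≤m m≤n) ⟩
            length ys * F
              ≤⟨ *-monoʳ-≤ (length ys) (m≤n+m F (measure d counter * (E + A))) ⟩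
            length ys * level (measure d counter) ∎
        ; length-≤     = ≤-reflexive (↭-length (sort-↭ ys))
        ; inversions-≤ = subst (_≤ length ys * S)
            (sym (inversions-sorted (Sorted⇒AllPairs ℚ-totalOrder (sort-↗ ys)))) z≤n
        ; all          = All-resp-↭ (↭-sym (sort-↭ ys)) Pys
        }
        where
        open ≤-Reasoning
        open SortingAlgorithm fallback using (sort-↭; sort-↗)

    initial-outcome : ∀ {P} d xs bounds → Exhausted r (length xs) d →
      1 ≤ length xs → length xs ≤ n → All P xs →
      Outcome S (A + level (measure d 0)) (length xs) P (initial xs bounds)
    initial-outcome d xs (exact lo hi lo<hi _) exhausted 1≤m m≤n Pxs =
      distribute-outcome d xs k _ _ 0 _ exhausted 1≤m m≤n (m≤n+m k 2)
        (bucketIndex-mono (ℚ.<⇒≤ lo<hi) k) (bucketBounds-ordered (ℚ.<⇒≤ lo<hi) k) Pxs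
      where k = buckets (length xs)
    initial-outcome d xs (approximate lo hi lo<hi) exhausted 1≤m m≤n Pxs =
      distribute-outcome d xs (2 + k) _ _ 0 _ exhausted 1≤m m≤n ≤-refl
        (approxBucketIndex-mono lo<hi k) (approxBucketBounds-ordered xs lo<hi k) Pxs
      where k = buckets (length xs)

-- Total running time

lemma4p1 : (impl : Implementation) →
    WorstCaseO (λ xs → time (NFSSort.sort impl xs)) (λ n → n * ⌊log₂ n ⌋)
lemma4p1 impl
  with A , distribution≤ ← Analysis.∃-distributionCost-linear impl
     | E , equalityCheck≤ ← Analysis.∃-equalityCheckCost-linear impl
     | C , B , fallback≤ ← Analysis.∃-fallbackCost-log impl
     | r , 1≤r , α≤r/[1+r] ← fraction-bound (Implementation.0<α impl) (Implementation.α<1 impl)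
     | O , orderCheck≤ , O∈O ← Implementation.orderCheckCost-O impl
     | I , initialBounds≤ , I∈O ← Implementation.initialBoundsCost-O impl
  = T , sort-time , T∈Onlog
  where
  open Implementation impl
  open NFSSort impl

  depth coreFactor T : ℕ → ℕ
  -- The number of shrinkings supplied by `exhausted-log`.
  depth n = suc r * suc ⌊log₂ n ⌋
  -- The rate from `initial-outcome` with `level` written out and fallback rate `C * ⌊log₂ n ⌋ + B`.
  -- The leading `A` is the initial distribution, which has no equality check.
  coreFactor n = A + (measure (depth n) 0 * (E + A) + (C * ⌊log₂ n ⌋ + B))
  -- In order: initial checks, reversal, finding bounds, recursion, insertion sort. Reversal and the
  -- later phases are alternatives; the sum covers both.
  T n = O n + (n + (I n + (n * coreFactor n + (2 * n + 2 * (n * S)))))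

  insertionSort-after : ∀ {b n P run} → Outcome S b n P run →
                        time (run >>= insertionSort) ≤ n * b + (2 * n + 2 * (n * S))
  insertionSort-after {run = run} o = +-mono-≤ (time-≤ o)
    (≤-trans (insertionSort-time (value run))
      (+-mono-≤ (*-monoʳ-≤ 2 (length-≤ o)) (*-monoʳ-≤ 2 (inversions-≤ o))))

  -- Costs per element make sense only for a nonempty array; the empty one is returned as sorted.
  unsorted⇒nonempty : ∀ {xs} → ¬ Sorted xs → 1 ≤ length xs
  unsorted⇒nonempty {[]}    unsorted = contradiction [] unsorted
  unsorted⇒nonempty {_ ∷ _} _        = s≤s z≤n

  initial-sorts : ∀ xs → 1 ≤ length xs → (bounds : InitialBounds xs) →
    Outcome S (coreFactor (length xs)) (length xs) (λ _ → ⊤) (initial xs bounds)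
  initial-sorts xs 1≤n bounds =
    initial-outcome (depth n) xs bounds (exhausted-log r {{>-nonZero 1≤r}} n)
      1≤n ≤-refl (All.universal (λ _ → tt) xs)
    where
    n = length xs
    open Analysis.Recursion impl distribution≤ equalityCheck≤ α≤r/[1+r] (fallback≤ n)

  sortUnlessSorted-time : ∀ xs sorted? → time (sortUnlessSorted xs sorted?) ≤
    length xs + (I (length xs) + (length xs * coreFactor (length xs) +
      (2 * length xs + 2 * (length xs * S))))
  sortUnlessSorted-time xs (yes _)       = z≤n
  sortUnlessSorted-time xs (no unsorted) =
    if-elim (λ m → time m ≤ n + (I n + (n * coreFactor n + (2 * n + 2 * (n * S)))))
      (sorted? ℚ._≤?_ (reverse xs))
      (λ _ → +-monoʳ-≤ n z≤n)
      (λ _ → ≤-trans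
        (+-mono-≤ (initialBounds≤ xs)
          (insertionSort-after (initial-sorts xs (unsorted⇒nonempty unsorted)
            (initialBounds xs unsorted))))
        (m≤n+m _ n))
    where n = length xs

  sort-time : ∀ xs → time (sort xs) ≤ T (length xs)
  sort-time xs = +-mono-≤ (orderCheck≤ xs) (sortUnlessSorted-time xs (sorted? ℚ._≤?_ xs))

  coreFactor∈Olog : coreFactor ∈O ⌊log₂_⌋
  coreFactor∈Olog = ∈O-+ (constant∈Olog A) (∈O-+
    (∈O-scaleʳ (E + A) (∈O-+ (∈O-scaleʳ (suc c) (∈O-scaleˡ (suc r)
      (∈O-+ (constant∈Olog 1) log∈Olog))) (constant∈Olog c)))
    (∈O-+ (∈O-scaleˡ C log∈Olog) (constant∈Olog B)))

  T∈Onlog : T ∈O (λ n → n * ⌊log₂ n ⌋)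
  T∈Onlog =
    ∈O-+ (∈O-trans O∈O id∈Onlog)
    (∈O-+ id∈Onlog
    (∈O-+ (∈O-trans I∈O id∈Onlog)
    (∈O-+ (∈O-n* coreFactor∈Olog)
    (∈O-+ (∈O-scaleˡ 2 id∈Onlog)
          (∈O-scaleˡ 2 (∈O-n* (constant∈Olog S)))))))
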